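{- Let $n$ be a positive even integer. If there exists an orthogonal array $\mathrm{OA}(N,n,2,\frac n2-1)$, then $$N>\frac{0.409}{n}\cdot 2^n .$$
   Context: An orthogonal array $\mathrm{OA}(N,n,2,t)$ is a nonempty multiset $C$ of $N$ (counted with multiplicity) binary $n$-tuples from $\{0,1\}^n$ such that for any distinct coordinates $i_1,\ldots,i_t\in\{1,\ldots,n\}$ and any $a_1,\ldots,a_t\in\{0,1\}$, the number (with multiplicity) of $(x_1,\ldots,x_n)\in C$ with $x_{i_j}=a_j$, $j=1,\ldots,t$, equals $N/2^t$. -}

module Defs where

open import Data.Bool using (Bool)
import Data.Bool.Properties as Bool
open import Data.Fin using (Fin)
open import Data.Fin.Properties using (all?)
open import Data.List using (List; length; filter)
open import Data.Nat using (ℕ; _*_; _^_; _<_)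
open import Data.Vec using (Vec; lookup)
open import Function.Definitions using (Injective)
open import Relation.Binary.PropositionalEquality using (_≡_)

count : ∀ {n t} → (Fin t → Fin n) → (Fin t → Bool) → List (Vec Bool n) → ℕ
count i a C = length (filter (λ x → all? (λ j → lookup x (i j) Bool.≟ a j)) C)

-- A finite multiset is represented by a list; every condition below is
-- invariant under permuting the list.
record OA (N n t : ℕ) : Set where
  field
    rows     : List (Vec Bool n)
    size     : length rows ≡ N
    nonempty : 0 < N
    -- "count = N / 2ᵗ" as an exact (not rounded) quotient.
    balanced : (i : Fin t → Fin n) → Injective _≡_ _≡_ i →
               (a : Fin t → Bool) → count i a rows * 2 ^ t ≡ N

{-# OPTIONS --safe #-}

-- Linear programming bound.  Write Ĉ(u) = Σ_{x ∈ C} (-1)^{u·x} and S(u) = n − 2|u|.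
-- Strength t makes Ĉ vanish at 1 ≤ |u| ≤ t, and the weight W = S (n + S) is
-- nonpositive for n/2 ≤ |u| ≤ n; hence Σ_u W(u) Ĉ(u)² ≤ W(0) Ĉ(0)² = 2 n² N².
-- On the other hand that sum equals Σ_{x,y ∈ C} F(x ⊕ y), where the transform
-- F of W is nonnegative (S is a sum of n characters) and F(0) = n 2ⁿ, so it is at least N n 2ⁿ.
-- Therefore 2ⁿ ≤ 2 n N, which is stronger than the claim.
module Submission where

open import Data.Nat using (ℕ; NonZero; _∸_; _^_; _/_)
open import Data.Nat.Divisibility using (_∣_)
open import Data.Integer using (+_)
import Data.Rational as ℚ
open import Defs

open import Data.Bool using (Bool; true; false; _∧_; _xor_)
import Data.Bool.Properties as Bool
open import Data.Fin using (Fin; zero; suc)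
open import Data.Fin.Properties using (all?; suc-injective)
open import Data.Integer using (ℤ; -[1+_]; 0ℤ; 1ℤ; -1ℤ; _+_; _*_; -_; _≤_; _<_; +≤+; +<+; nonNegative)
import Data.Integer.Properties as ℤ
open import Data.Integer.Tactic.RingSolver using (solve-∀)
open import Data.List using (List; []; _∷_; _++_; map; length; filter)
open import Data.List.Membership.Propositional using (_∈_)
open import Data.List.Relation.Unary.Any using (here; there)
open import Data.Nat using (zero; suc; z≤n; s≤s)
import Data.Nat as ℕ
import Data.Nat.DivMod as ℕ
open import Data.Nat.Divisibility using (divides)
import Data.Nat.Properties as ℕ
import Data.Nat.Tactic.RingSolver as ℕ-Solver
import Data.Rational.Properties as ℚ
open import Data.Rational.Unnormalised using (mkℚᵘ; *<*)
import Data.Rational.Unnormalised as ℚᵘ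
import Data.Rational.Unnormalised.Properties as ℚᵘ
open import Data.Vec using (Vec; []; _∷_; lookup; tabulate; replicate; zipWith)
open import Data.Vec.Properties using (tabulate-cong; tabulate∘lookup; lookup∘tabulate)
open import Function using (_∘_)
open import Function.Definitions using (Injective)
open import Relation.Binary.PropositionalEquality using (_≡_; _≢_; refl; sym; trans; cong; cong₂; subst; subst₂; module ≡-Reasoning)
open import Relation.Nullary using (Dec; yes; no; contradiction)

private
  variable
    A B : Set
    n t : ℕ

-- Finite sums

∑ : List A → (A → ℤ) → ℤ
∑ []       f = 0ℤ
∑ (x ∷ xs) f = f x + ∑ xs f

∑-cong : ∀ (xs : List A) {f g : A → ℤ} → (∀ x → f x ≡ g x) → ∑ xs f ≡ ∑ xs g
∑-cong []       f≗g = refl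
∑-cong (x ∷ xs) f≗g = cong₂ _+_ (f≗g x) (∑-cong xs f≗g)

∑-zero : ∀ (xs : List A) → ∑ xs (λ _ → 0ℤ) ≡ 0ℤ
∑-zero []       = refl
∑-zero (_ ∷ xs) = trans (ℤ.+-identityˡ _) (∑-zero xs)

∑-const : ∀ (xs : List A) c → ∑ xs (λ _ → c) ≡ + length xs * c
∑-const []       c = refl
∑-const (_ ∷ xs) c = trans (cong (_+_ c) (∑-const xs c)) (sym (ℤ.suc-* (+ length xs) c))

∑-distrib-+ : ∀ (xs : List A) (f g : A → ℤ) → ∑ xs (λ x → f x + g x) ≡ ∑ xs f + ∑ xs g
∑-distrib-+ []       f g = refl
∑-distrib-+ (x ∷ xs) f g = trans (cong (_+_ (f x + g x)) (∑-distrib-+ xs f g)) (interchange (f x) (g x) (∑ xs f) (∑ xs g))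
  where
  interchange : ∀ a b c d → a + b + (c + d) ≡ a + c + (b + d)
  interchange = solve-∀

*-distribˡ-∑ : ∀ c (xs : List A) (f : A → ℤ) → c * ∑ xs f ≡ ∑ xs (λ x → c * f x)
*-distribˡ-∑ c []       f = ℤ.*-zeroʳ c
*-distribˡ-∑ c (x ∷ xs) f = trans (ℤ.*-distribˡ-+ c (f x) (∑ xs f)) (cong (_+_ (c * f x)) (*-distribˡ-∑ c xs f))

*-distribʳ-∑ : ∀ c (xs : List A) (f : A → ℤ) → ∑ xs f * c ≡ ∑ xs (λ x → f x * c)
*-distribʳ-∑ c []       f = refl
*-distribʳ-∑ c (x ∷ xs) f = trans (ℤ.*-distribʳ-+ c (f x) (∑ xs f)) (cong (_+_ (f x * c)) (*-distribʳ-∑ c xs f))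

∑-swap : ∀ (xs : List A) (ys : List B) (f : A → B → ℤ) →
         ∑ xs (λ x → ∑ ys (f x)) ≡ ∑ ys (λ y → ∑ xs (λ x → f x y))
∑-swap []       ys f = sym (∑-zero ys)
∑-swap (x ∷ xs) ys f = trans (cong (_+_ (∑ ys (f x))) (∑-swap xs ys f)) (sym (∑-distrib-+ ys (f x) (λ y → ∑ xs (λ x′ → f x′ y))))

∑-++ : ∀ (xs ys : List A) (f : A → ℤ) → ∑ (xs ++ ys) f ≡ ∑ xs f + ∑ ys f
∑-++ []       ys f = sym (ℤ.+-identityˡ _)
∑-++ (x ∷ xs) ys f = trans (cong (_+_ (f x)) (∑-++ xs ys f)) (sym (ℤ.+-assoc (f x) _ _))

∑-map : ∀ (h : A → B) (xs : List A) (f : B → ℤ) → ∑ (map h xs) f ≡ ∑ xs (f ∘ h)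
∑-map h []       f = refl
∑-map h (x ∷ xs) f = cong (_+_ (f (h x))) (∑-map h xs f)

∑-square : ∀ (xs : List A) (f : A → ℤ) → ∑ xs f * ∑ xs f ≡ ∑ xs (λ x → ∑ xs (λ y → f x * f y))
∑-square xs f = trans (*-distribʳ-∑ _ xs f) (∑-cong xs λ x → *-distribˡ-∑ (f x) xs f)

∑-nonneg : ∀ (xs : List A) {f : A → ℤ} → (∀ x → 0ℤ ≤ f x) → 0ℤ ≤ ∑ xs f
∑-nonneg []       0≤f = ℤ.≤-refl
∑-nonneg (x ∷ xs) 0≤f = ℤ.+-mono-≤ (0≤f x) (∑-nonneg xs 0≤f)

∑-nonpos : ∀ (xs : List A) {f : A → ℤ} → (∀ x → f x ≤ 0ℤ) → ∑ xs f ≤ 0ℤ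
∑-nonpos []       f≤0 = ℤ.≤-refl
∑-nonpos (x ∷ xs) f≤0 = ℤ.+-mono-≤ (f≤0 x) (∑-nonpos xs f≤0)

-- The comparison is asked only at entries of the list because the diagonal bound in `energy-lower`
-- is available only at actual rows.
∑-mono-∈ : ∀ (xs : List A) {f g : A → ℤ} → (∀ x → x ∈ xs → f x ≤ g x) → ∑ xs f ≤ ∑ xs g
∑-mono-∈ []       f≤g = ℤ.≤-refl
∑-mono-∈ (x ∷ xs) f≤g = ℤ.+-mono-≤ (f≤g x (here refl)) (∑-mono-∈ xs λ y y∈xs → f≤g y (there y∈xs))

term≤∑ : ∀ {xs : List A} {x} {f : A → ℤ} → (∀ y → 0ℤ ≤ f y) → x ∈ xs → f x ≤ ∑ xs f
term≤∑ {xs = y ∷ ys} {x} {f} 0≤f (here refl) =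
  subst (_≤ f x + ∑ ys f) (ℤ.+-identityʳ (f x)) (ℤ.+-monoʳ-≤ (f x) (∑-nonneg ys 0≤f))
term≤∑ {xs = y ∷ ys} {x} {f} 0≤f (there x∈ys) =
  subst (_≤ f y + ∑ ys f) (ℤ.+-identityˡ (f x)) (ℤ.+-mono-≤ (0≤f y) (term≤∑ 0≤f x∈ys))

-- Sums over the binary cube

zeros : Vec Bool n
zeros = replicate _ false

weight : Vec Bool n → ℕ
weight []          = 0
weight (false ∷ u) = weight u
weight (true  ∷ u) = suc (weight u)

cube : ∀ n → List (Vec Bool n)
cube zero    = [] ∷ []
cube (suc n) = map (false ∷_) (cube n) ++ map (true ∷_) (cube n)

∑-cube : ∀ (f : Vec Bool (suc n) → ℤ) →
         ∑ (cube (suc n)) f ≡ ∑ (cube n) (λ u → f (false ∷ u)) + ∑ (cube n) (λ u → f (true ∷ u))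
∑-cube {n} f = trans (∑-++ (map (false ∷_) (cube n)) _ f)
                     (cong₂ _+_ (∑-map (false ∷_) (cube n) f) (∑-map (true ∷_) (cube n) f))

-- Pairing the vectors that differ only in their first bit turns each transform below into a
-- one-step recursion; `c = 0` covers the case where the pairs cancel.
∑-cube-fold : ∀ {f : Vec Bool (suc n) → ℤ} {g : Vec Bool n → ℤ} c →
              (∀ u → f (false ∷ u) + f (true ∷ u) ≡ c * g u) →
              ∑ (cube (suc n)) f ≡ c * ∑ (cube n) g
∑-cube-fold {n} {f} {g} c eq = begin
  ∑ (cube (suc n)) f                                                ≡⟨ ∑-cube f ⟩
  ∑ (cube n) (λ u → f (false ∷ u)) + ∑ (cube n) (λ u → f (true ∷ u)) ≡⟨ ∑-distrib-+ (cube n) _ _ ⟨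
  ∑ (cube n) (λ u → f (false ∷ u) + f (true ∷ u))                   ≡⟨ ∑-cong (cube n) eq ⟩
  ∑ (cube n) (λ u → c * g u)                                        ≡⟨ *-distribˡ-∑ c (cube n) g ⟨
  c * ∑ (cube n) g                                                  ∎
  where open ≡-Reasoning

∑-cube-single : ∀ (b : Vec Bool n) {f : Vec Bool n → ℤ} →
                (∀ a → a ≢ b → f a ≡ 0ℤ) → ∑ (cube n) f ≡ f b
∑-cube-single []          {f} f≡0 = ℤ.+-identityʳ _
∑-cube-single {suc n} (false ∷ b) {f} f≡0 = trans (∑-cube f) (trans
  (cong₂ _+_ (∑-cube-single b λ a a≢b → f≡0 (false ∷ a) λ { refl → a≢b refl })
             (trans (∑-cong (cube n) λ a → f≡0 (true ∷ a) λ ()) (∑-zero (cube n))))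
  (ℤ.+-identityʳ _))
∑-cube-single {suc n} (true ∷ b) {f} f≡0 = trans (∑-cube f) (trans
  (cong₂ _+_ (trans (∑-cong (cube n) λ a → f≡0 (false ∷ a) λ ()) (∑-zero (cube n)))
             (∑-cube-single b λ a a≢b → f≡0 (true ∷ a) λ { refl → a≢b refl }))
  (ℤ.+-identityˡ _))

-- The zero vector is the only one of weight 0, so every other term may be dropped from an upper
-- bound.
∑-cube≤zeros : ∀ n {f : Vec Bool n → ℤ} →
               (∀ u → 0 ℕ.< weight u → f u ≤ 0ℤ) → ∑ (cube n) f ≤ f zeros
∑-cube≤zeros zero    {f} f≤0 = ℤ.≤-reflexive (ℤ.+-identityʳ _)
∑-cube≤zeros (suc n) {f} f≤0 = ℤ.≤-trans (ℤ.≤-reflexive (∑-cube f)) (ℤ.≤-trans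
  (ℤ.+-mono-≤ (∑-cube≤zeros n λ u 0<w → f≤0 (false ∷ u) 0<w)
              (∑-nonpos (cube n) λ u → f≤0 (true ∷ u) (s≤s z≤n)))
  (ℤ.≤-reflexive (ℤ.+-identityʳ _)))

-- Characters

sgn : Bool → ℤ
sgn false = 1ℤ
sgn true  = -1ℤ

χ : Vec Bool n → Vec Bool n → ℤ
χ []      []      = 1ℤ
χ (a ∷ u) (b ∷ x) = sgn (a ∧ b) * χ u x

infixl 6 _⊕_

_⊕_ : Vec Bool n → Vec Bool n → Vec Bool n
_⊕_ = zipWith _xor_

x⊕x≡zeros : ∀ (x : Vec Bool n) → x ⊕ x ≡ zeros
x⊕x≡zeros []      = refl
x⊕x≡zeros (b ∷ x) = cong₂ _∷_ (Bool.xor-same b) (x⊕x≡zeros x)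

χ-comm : ∀ (u x : Vec Bool n) → χ u x ≡ χ x u
χ-comm []      []      = refl
χ-comm (a ∷ u) (b ∷ x) = cong₂ _*_ (cong sgn (Bool.∧-comm a b)) (χ-comm u x)

χ-zeros : ∀ (x : Vec Bool n) → χ zeros x ≡ 1ℤ
χ-zeros []      = refl
χ-zeros (_ ∷ x) = trans (ℤ.*-identityˡ _) (χ-zeros x)

χ-⊕ : ∀ (u x y : Vec Bool n) → χ u x * χ u y ≡ χ u (x ⊕ y)
χ-⊕ []      []      []      = refl
χ-⊕ (a ∷ u) (b ∷ x) (c ∷ y) =
  trans (interchange (sgn (a ∧ b)) (χ u x) (sgn (a ∧ c)) (χ u y)) (cong₂ _*_ (sgn-⊕ a b c) (χ-⊕ u x y))
  where
  interchange : ∀ p q r s → p * q * (r * s) ≡ p * r * (q * s)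
  interchange = solve-∀
  sgn-⊕ : ∀ a b c → sgn (a ∧ b) * sgn (a ∧ c) ≡ sgn (a ∧ (b xor c))
  sgn-⊕ false b     c     = refl
  sgn-⊕ true  false false = refl
  sgn-⊕ true  false true  = refl
  sgn-⊕ true  true  false = refl
  sgn-⊕ true  true  true  = refl

-- This is the first Krawtchouk polynomial n - 2|u|, kept as a sum of the n coordinate characters so
-- that its transform can be computed one bit at a time.
S : Vec Bool n → ℤ
S []      = 0ℤ
S (a ∷ u) = sgn a + S u

S-weight : ∀ (u : Vec Bool n) → S u + (+ weight u + + weight u) ≡ + n
S-weight []          = refl
S-weight (false ∷ u) = trans (shift (S u) (+ weight u)) (cong (_+_ 1ℤ) (S-weight u))
  where
  shift : ∀ s w → 1ℤ + s + (w + w) ≡ 1ℤ + (s + (w + w))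
  shift = solve-∀
S-weight (true ∷ u) = trans (shift (S u) (+ weight u)) (cong (_+_ 1ℤ) (S-weight u))
  where
  shift : ∀ s w → -1ℤ + s + (1ℤ + w + (1ℤ + w)) ≡ 1ℤ + (s + (w + w))
  shift = solve-∀

S-zeros : ∀ n → S (zeros {n}) ≡ + n
S-zeros zero    = refl
S-zeros (suc n) = cong (_+_ 1ℤ) (S-zeros n)

-- Fourier transforms of 1, S and S²

M₀ M₁ M₂ : Vec Bool n → ℤ
M₀ {n} z = ∑ (cube n) (λ u → χ u z)
M₁ {n} z = ∑ (cube n) (λ u → S u * χ u z)
M₂ {n} z = ∑ (cube n) (λ u → S u * S u * χ u z)

-- In this and the next five recursions the first bit of u shifts S by 1 or -1. If z starts with
-- `false`, the two halves add; if it starts with `true`, they are subtracted, which lowers the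
-- degree in S by one: (s + 1)² - (s - 1)² = 4s.
M₀-false : ∀ (z : Vec Bool n) → M₀ (false ∷ z) ≡ + 2 * M₀ z
M₀-false z = ∑-cube-fold (+ 2) λ u → eq (χ u z)
  where
  eq : ∀ c → 1ℤ * c + 1ℤ * c ≡ + 2 * c
  eq = solve-∀

M₀-true : ∀ (z : Vec Bool n) → M₀ (true ∷ z) ≡ 0ℤ
M₀-true z = ∑-cube-fold {g = λ u → χ u z} 0ℤ λ u → eq (χ u z)
  where
  eq : ∀ c → 1ℤ * c + -1ℤ * c ≡ 0ℤ * c
  eq = solve-∀

M₁-false : ∀ (z : Vec Bool n) → M₁ (false ∷ z) ≡ + 2 * M₁ z
M₁-false z = ∑-cube-fold (+ 2) λ u → eq (S u) (χ u z)
  where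
  eq : ∀ s c → (1ℤ + s) * (1ℤ * c) + (-1ℤ + s) * (1ℤ * c) ≡ + 2 * (s * c)
  eq = solve-∀

M₁-true : ∀ (z : Vec Bool n) → M₁ (true ∷ z) ≡ + 2 * M₀ z
M₁-true z = ∑-cube-fold (+ 2) λ u → eq (S u) (χ u z)
  where
  eq : ∀ s c → (1ℤ + s) * (1ℤ * c) + (-1ℤ + s) * (-1ℤ * c) ≡ + 2 * c
  eq = solve-∀

M₂-false : ∀ (z : Vec Bool n) → M₂ (false ∷ z) ≡ + 2 * (M₂ z + M₀ z)
M₂-false {n} z = trans (∑-cube-fold (+ 2) λ u → eq (S u) (χ u z))
                       (cong (+ 2 *_) (∑-distrib-+ (cube n) _ _))
  where
  eq : ∀ s c → (1ℤ + s) * (1ℤ + s) * (1ℤ * c) + (-1ℤ + s) * (-1ℤ + s) * (1ℤ * c) ≡ + 2 * (s * s * c + c)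
  eq = solve-∀

M₂-true : ∀ (z : Vec Bool n) → M₂ (true ∷ z) ≡ + 4 * M₁ z
M₂-true z = ∑-cube-fold (+ 4) λ u → eq (S u) (χ u z)
  where
  eq : ∀ s c → (1ℤ + s) * (1ℤ + s) * (1ℤ * c) + (-1ℤ + s) * (-1ℤ + s) * (-1ℤ * c) ≡ + 4 * (s * c)
  eq = solve-∀

0≤+* : ∀ k {i j} → i ≡ + k * j → 0ℤ ≤ j → 0ℤ ≤ i
0≤+* k {j = j} refl 0≤j = subst (_≤ + k * j) (ℤ.*-zeroʳ (+ k)) (ℤ.*-monoˡ-≤-nonNeg (+ k) 0≤j)

-- In closed form, `M₀`, `M₁` and `M₂` are 2ⁿ times the number of ways to write z as a sum of 0, 1
-- and 2 unit vectors, in order. The recursions have nonnegative coefficients, so the signs follow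
-- without the closed forms.
M₀-nonneg : ∀ (z : Vec Bool n) → 0ℤ ≤ M₀ z
M₀-nonneg []          = +≤+ z≤n
M₀-nonneg (false ∷ z) = 0≤+* 2 (M₀-false z) (M₀-nonneg z)
M₀-nonneg (true  ∷ z) = ℤ.≤-reflexive (sym (M₀-true z))

M₁-nonneg : ∀ (z : Vec Bool n) → 0ℤ ≤ M₁ z
M₁-nonneg []          = +≤+ z≤n
M₁-nonneg (false ∷ z) = 0≤+* 2 (M₁-false z) (M₁-nonneg z)
M₁-nonneg (true  ∷ z) = 0≤+* 2 (M₁-true z) (M₀-nonneg z)

M₂-nonneg : ∀ (z : Vec Bool n) → 0ℤ ≤ M₂ z
M₂-nonneg []          = +≤+ z≤n
M₂-nonneg (false ∷ z) = 0≤+* 2 (M₂-false z) (ℤ.+-mono-≤ (M₂-nonneg z) (M₀-nonneg z))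
M₂-nonneg (true  ∷ z) = 0≤+* 4 (M₂-true z) (M₁-nonneg z)

M₀-zeros : ∀ n → M₀ (zeros {n}) ≡ + (2 ^ n)
M₀-zeros zero    = refl
M₀-zeros (suc n) = trans (M₀-false (zeros {n}))
  (trans (cong (+ 2 *_) (M₀-zeros n)) (sym (ℤ.pos-* 2 (2 ^ n))))

M₁-zeros : ∀ n → M₁ (zeros {n}) ≡ 0ℤ
M₁-zeros zero    = refl
M₁-zeros (suc n) = trans (M₁-false (zeros {n})) (cong (+ 2 *_) (M₁-zeros n))

M₂-zeros : ∀ n → M₂ (zeros {n}) ≡ + n * + (2 ^ n)
M₂-zeros zero    = refl
M₂-zeros (suc n) = begin
  M₂ (zeros {suc n})                     ≡⟨ M₂-false (zeros {n}) ⟩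
  + 2 * (M₂ (zeros {n}) + M₀ (zeros {n})) ≡⟨ cong (+ 2 *_) (cong₂ _+_ (M₂-zeros n) (M₀-zeros n)) ⟩
  + 2 * (+ n * + (2 ^ n) + + (2 ^ n))    ≡⟨ eq (+ n) (+ (2 ^ n)) ⟩
  (1ℤ + + n) * (+ 2 * + (2 ^ n))         ≡⟨ cong ((1ℤ + + n) *_) (ℤ.pos-* 2 (2 ^ n)) ⟨
  + suc n * + (2 ^ suc n)                ∎
  where
  open ≡-Reasoning
  eq : ∀ m p → + 2 * (m * p + p) ≡ (1ℤ + m) * (+ 2 * p)
  eq = solve-∀

-- Orthogonality of characters: at the first `true` bit of z the two halves of the cube cancel.
M₀-nonzero : ∀ (z : Vec Bool n) → 0 ℕ.< weight z → M₀ z ≡ 0ℤ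
M₀-nonzero (false ∷ z) 0<w = trans (M₀-false z) (cong (+ 2 *_) (M₀-nonzero z 0<w))
M₀-nonzero (true  ∷ z) 0<w = M₀-true z

-- The quadratic weight and its Fourier transform

W : Vec Bool n → ℤ
W {n} u = S u * (+ n + S u)

F : Vec Bool n → ℤ
F {n} z = ∑ (cube n) (λ u → W u * χ u z)

-- Expanding W = n S + S² reduces both the sign of `F` and its value at zero to the moments.
F-moments : ∀ (z : Vec Bool n) → F z ≡ + n * M₁ z + M₂ z
F-moments {n} z = begin
  ∑ (cube n) (λ u → W u * χ u z)                              ≡⟨ ∑-cong (cube n) (λ u → eq (+ n) (S u) (χ u z)) ⟩
  ∑ (cube n) (λ u → + n * (S u * χ u z) + S u * S u * χ u z)  ≡⟨ ∑-distrib-+ (cube n) _ _ ⟩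
  ∑ (cube n) (λ u → + n * (S u * χ u z)) + M₂ z               ≡⟨ cong (_+ M₂ z) (*-distribˡ-∑ (+ n) (cube n) _) ⟨
  + n * M₁ z + M₂ z                                           ∎
  where
  open ≡-Reasoning
  eq : ∀ m s c → s * (m + s) * c ≡ m * (s * c) + s * s * c
  eq = solve-∀

F-nonneg : ∀ (z : Vec Bool n) → 0ℤ ≤ F z
F-nonneg {n} z = subst (0ℤ ≤_) (sym (F-moments z))
  (ℤ.+-mono-≤ (0≤+* n refl (M₁-nonneg z)) (M₂-nonneg z))

-- Only S² contributes, because S sums to zero over the cube.
F-zeros : ∀ n → F (zeros {n}) ≡ + n * + (2 ^ n)
F-zeros n = begin
  F (zeros {n})                               ≡⟨ F-moments (zeros {n}) ⟩
  + n * M₁ (zeros {n}) + M₂ (zeros {n})       ≡⟨ cong₂ (λ i j → + n * i + j) (M₁-zeros n) (M₂-zeros n) ⟩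
  + n * 0ℤ + + n * + (2 ^ n)                  ≡⟨ cong (_+ + n * + (2 ^ n)) (ℤ.*-zeroʳ (+ n)) ⟩
  0ℤ + + n * + (2 ^ n)                        ≡⟨ ℤ.+-identityˡ _ ⟩
  + n * + (2 ^ n)                             ∎
  where open ≡-Reasoning

weight≤n : ∀ (u : Vec Bool n) → weight u ℕ.≤ n
weight≤n []          = z≤n
weight≤n (false ∷ u) = ℕ.m≤n⇒m≤1+n (weight≤n u)
weight≤n (true  ∷ u) = s≤s (weight≤n u)

-- With w = |u| the factors are S = n - 2w, nonpositive by hypothesis, and n + S = 2(n - w),
-- nonnegative because w ≤ n.
W-nonpos : ∀ (u : Vec Bool n) → n ℕ.≤ weight u ℕ.+ weight u → W u ≤ 0ℤ
W-nonpos {n} u n≤2w = subst (W u ≤_) (ℤ.*-zeroˡ (+ n + S u))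
  (ℤ.*-monoʳ-≤-nonNeg (+ n + S u) {{nonNegative 0≤n+S}} S≤0)
  where
  w : ℤ
  w = + weight u
  S-split : ∀ s v → s ≡ s + (v + v) + - (v + v)
  S-split = solve-∀
  S≡ : S u ≡ + n + - (w + w)
  S≡ = trans (S-split (S u) w) (cong (_+ - (w + w)) (S-weight u))
  S≤0 : S u ≤ 0ℤ
  S≤0 = subst (_≤ 0ℤ) (sym S≡) (ℤ.i≤j⇒i-j≤0 (+≤+ n≤2w))
  n+S-split : ∀ m v → m + (m + - (v + v)) ≡ m + m + - (v + v)
  n+S-split = solve-∀
  0≤n+S : 0ℤ ≤ + n + S u
  0≤n+S = subst (0ℤ ≤_) (sym (trans (cong (_+_ (+ n)) S≡) (n+S-split (+ n) w)))
    (ℤ.i≤j⇒0≤j-i (+≤+ (ℕ.+-mono-≤ (weight≤n u) (weight≤n u))))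

-- Vanishing of the low Fourier coefficients

-- Patterns are vectors here, although `count` takes functions: vectors are enumerated by `cube t`
-- and compared by `≡` without function extensionality.
restrict : (Fin t → Fin n) → Vec Bool n → Vec Bool t
restrict i x = tabulate (λ j → lookup x (i j))

-- This repeats the test inside `count`, so that `count` unfolds to a filter by `agree?`.
agree? : (i : Fin t → Fin n) (a : Fin t → Bool) (x : Vec Bool n) → Dec (∀ j → lookup x (i j) ≡ a j)
agree? i a x = all? (λ j → lookup x (i j) Bool.≟ a j)

𝟙 : {P : Set} → Dec P → ℤ
𝟙 (yes _) = 1ℤ
𝟙 (no  _) = 0ℤ

length-filter-∑ : ∀ {P : A → Set} (P? : ∀ x → Dec (P x)) xs → + length (filter P? xs) ≡ ∑ xs (λ x → 𝟙 (P? x))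
length-filter-∑ P? []       = refl
length-filter-∑ P? (x ∷ xs) with P? x
... | yes _ = cong (_+_ 1ℤ) (length-filter-∑ P? xs)
... | no  _ = trans (length-filter-∑ P? xs) (sym (ℤ.+-identityˡ _))

-- Exactly one pattern agrees with x on the chosen coordinates, so a single term survives.
∑-agree : ∀ (i : Fin t → Fin n) (g : Vec Bool t → ℤ) x →
          ∑ (cube t) (λ a → 𝟙 (agree? i (lookup a) x) * g a) ≡ g (restrict i x)
∑-agree {t} i g x = trans (∑-cube-single (restrict i x) off) on
  where
  off : ∀ a → a ≢ restrict i x → 𝟙 (agree? i (lookup a) x) * g a ≡ 0ℤ
  off a a≢ with agree? i (lookup a) x
  ... | yes eq = contradiction (sym (trans (tabulate-cong eq) (tabulate∘lookup a))) a≢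
  ... | no  _  = refl
  on : 𝟙 (agree? i (lookup (restrict i x)) x) * g (restrict i x) ≡ g (restrict i x)
  on with agree? i (lookup (restrict i x)) x
  ... | yes _  = ℤ.*-identityˡ _
  ... | no  ¬p = contradiction (λ j → sym (lookup∘tabulate _ j)) ¬p

-- Rows are grouped by their pattern on the chosen coordinates; the group sizes are what `balanced`
-- controls.
∑-restrict : ∀ (i : Fin t → Fin n) (g : Vec Bool t → ℤ) C →
             ∑ C (λ x → g (restrict i x)) ≡ ∑ (cube t) (λ a → + count i (lookup a) C * g a)
∑-restrict {t} i g C = begin
  ∑ C (λ x → g (restrict i x))                                        ≡⟨ ∑-cong C (λ x → sym (∑-agree i g x)) ⟩
  ∑ C (λ x → ∑ (cube t) (λ a → 𝟙 (agree? i (lookup a) x) * g a))      ≡⟨ ∑-swap C (cube t) _ ⟩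
  ∑ (cube t) (λ a → ∑ C (λ x → 𝟙 (agree? i (lookup a) x) * g a))      ≡⟨ ∑-cong (cube t) (λ a → sym (*-distribʳ-∑ (g a) C _)) ⟩
  ∑ (cube t) (λ a → ∑ C (λ x → 𝟙 (agree? i (lookup a) x)) * g a)      ≡⟨ ∑-cong (cube t) (λ a → cong (_* g a) (sym (length-filter-∑ (agree? i (lookup a)) C))) ⟩
  ∑ (cube t) (λ a → + count i (lookup a) C * g a)                     ∎
  where open ≡-Reasoning

-- `balanced` speaks of exactly t distinct coordinates, while the support of u may be smaller. A
-- cover is a choice of t coordinates containing that support, with `mask` the part of u seen there,
-- so that the character of u depends on those coordinates alone.
record Cover (u : Vec Bool n) (t : ℕ) : Set where
  field
    coords    : Fin t → Fin n
    injective : Injective _≡_ _≡_ coords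
    mask      : Vec Bool t
    same      : weight mask ≡ weight u
    χ-coords  : ∀ x → χ u x ≡ χ mask (restrict coords x)

skip : ∀ {u : Vec Bool n} → Cover u t → Cover (false ∷ u) t
skip c = record
  { coords    = suc ∘ coords
  ; injective = injective ∘ suc-injective
  ; mask      = mask
  ; same      = same
  ; χ-coords  = λ { (_ ∷ x) → trans (ℤ.*-identityˡ _) (χ-coords x) }
  } where open Cover c

keep : ∀ {u : Vec Bool n} b → Cover u t → Cover (b ∷ u) (suc t)
keep {n} {t} {u} b c = record
  { coords    = coords′
  ; injective = injective′
  ; mask      = b ∷ mask
  ; same      = same′ b
  ; χ-coords  = λ { (d ∷ x) → cong (sgn (b ∧ d) *_) (χ-coords x) }
  }
  where
  open Cover c
  coords′ : Fin (suc t) → Fin (suc n)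
  coords′ zero    = zero
  coords′ (suc j) = suc (coords j)
  injective′ : Injective _≡_ _≡_ coords′
  injective′ {zero}  {zero}  _  = refl
  injective′ {suc j} {suc k} eq = cong suc (injective (suc-injective eq))
  same′ : ∀ b → weight (b ∷ mask) ≡ weight (b ∷ u)
  same′ false = same
  same′ true  = cong suc same

-- Greedy choice: `true` bits are always kept, and a `false` bit is skipped as long as t coordinates
-- still fit into the remaining ones.
cover : ∀ (u : Vec Bool n) t → weight u ℕ.≤ t → t ℕ.≤ n → Cover u t
cover [] zero _ _ = record
  { coords = λ () ; injective = λ { {()} } ; mask = [] ; same = refl ; χ-coords = λ { [] → refl } }
cover (true ∷ u) (suc t) (s≤s w≤t) (s≤s t≤n) = keep true (cover u t w≤t t≤n)
cover {suc n} (false ∷ u) t w≤t t≤1+n with t ℕ.≤? n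
... | yes t≤n = skip (cover u t w≤t t≤n)
cover {suc n} (false ∷ u) zero    w≤t _          | no t≰n = contradiction z≤n t≰n
-- Every remaining coordinate is needed here: n ≤ t, so the `false` bit is kept as padding, and |u|
-- ≤ n gives the weight bound for the tail.
cover {suc n} (false ∷ u) (suc t) w≤t (s≤s t≤n)  | no t≰n =
  keep false (cover u t (ℕ.≤-trans (weight≤n u) (ℕ.≮⇒≥ t≰n)) t≤n)

-- The linear programming bound for an orthogonal array

module _ {N n t : ℕ} (oa : OA N n t) where
  open OA oa

  transform : Vec Bool n → ℤ
  transform u = ∑ rows (χ u)

  transform-zeros : transform zeros ≡ + N
  transform-zeros = begin
    ∑ rows (χ zeros)      ≡⟨ ∑-cong rows χ-zeros ⟩
    ∑ rows (λ _ → 1ℤ)     ≡⟨ ∑-const rows 1ℤ ⟩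
    + length rows * 1ℤ    ≡⟨ ℤ.*-identityʳ _ ⟩
    + length rows         ≡⟨ cong +_ size ⟩
    + N                   ∎
    where open ≡-Reasoning

  -- On a cover of u all patterns occur equally often, so the coefficient is N / 2ᵗ times the sum of
  -- a nontrivial character over the t-cube.
  transform-vanishes : t ℕ.≤ n → ∀ u → 0 ℕ.< weight u → weight u ℕ.≤ t → transform u ≡ 0ℤ
  transform-vanishes t≤n u 0<w w≤t =
    -- The quotient N / 2ᵗ is available only in multiplied form, so the identity is proved after
    -- scaling by 2ᵗ.
    ℤ.*-cancelˡ-≡ (+ (2 ^ t)) _ _ {{ℕ.m^n≢0 2 t}} (trans scaled (sym (ℤ.*-zeroʳ (+ (2 ^ t)))))
    where
    open Cover (cover u t w≤t t≤n)
    open ≡-Reasoning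
    balanced-ℤ : ∀ a → + (2 ^ t) * (+ count coords (lookup a) rows * χ mask a) ≡ + N * χ a mask
    balanced-ℤ a = begin
      + (2 ^ t) * (+ count coords (lookup a) rows * χ mask a)  ≡⟨ rearrange (+ (2 ^ t)) (+ count coords (lookup a) rows) (χ mask a) ⟩
      + count coords (lookup a) rows * + (2 ^ t) * χ mask a    ≡⟨ cong (_* χ mask a) (ℤ.pos-* (count coords (lookup a) rows) (2 ^ t)) ⟨
      -- The arguments of `χ` are swapped so that the sum over patterns becomes `M₀ mask`.
      + (count coords (lookup a) rows ℕ.* 2 ^ t) * χ mask a    ≡⟨ cong₂ (λ k c → + k * c) (balanced coords injective (lookup a)) (χ-comm mask a) ⟩
      + N * χ a mask                                           ∎
      where
      rearrange : ∀ p k c → p * (k * c) ≡ k * p * c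
      rearrange = solve-∀
    scaled : + (2 ^ t) * transform u ≡ 0ℤ
    scaled = begin
      + (2 ^ t) * ∑ rows (χ u)
        ≡⟨ cong (+ (2 ^ t) *_) (trans (∑-cong rows χ-coords) (∑-restrict coords (χ mask) rows)) ⟩
      + (2 ^ t) * ∑ (cube t) (λ a → + count coords (lookup a) rows * χ mask a)
        ≡⟨ *-distribˡ-∑ (+ (2 ^ t)) (cube t) _ ⟩
      ∑ (cube t) (λ a → + (2 ^ t) * (+ count coords (lookup a) rows * χ mask a))
        ≡⟨ ∑-cong (cube t) balanced-ℤ ⟩
      ∑ (cube t) (λ a → + N * χ a mask)
        ≡⟨ *-distribˡ-∑ (+ N) (cube t) _ ⟨
      + N * M₀ mask
        ≡⟨ cong (+ N *_) (M₀-nonzero mask (subst (0 ℕ.<_) (sym same) 0<w)) ⟩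
      + N * 0ℤ
        ≡⟨ ℤ.*-zeroʳ (+ N) ⟩
      0ℤ ∎

  energy : ℤ
  energy = ∑ (cube n) (λ u → W u * (transform u * transform u))

  -- A Parseval-type identity: the square expands into pairs of rows, `χ-⊕` merges the two
  -- characters, and summing over u first produces `F`.
  energy-pairs : energy ≡ ∑ rows (λ x → ∑ rows (λ y → F (x ⊕ y)))
  energy-pairs = begin
    ∑ (cube n) (λ u → W u * (transform u * transform u))
      ≡⟨ ∑-cong (cube n) expand ⟩
    ∑ (cube n) (λ u → ∑ rows (λ x → ∑ rows (λ y → W u * χ u (x ⊕ y))))
      ≡⟨ ∑-swap (cube n) rows _ ⟩
    ∑ rows (λ x → ∑ (cube n) (λ u → ∑ rows (λ y → W u * χ u (x ⊕ y))))
      ≡⟨ ∑-cong rows (λ x → ∑-swap (cube n) rows _) ⟩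
    ∑ rows (λ x → ∑ rows (λ y → F (x ⊕ y))) ∎
    where
    open ≡-Reasoning
    expand : ∀ u → W u * (transform u * transform u) ≡ ∑ rows (λ x → ∑ rows (λ y → W u * χ u (x ⊕ y)))
    expand u = begin
      W u * (transform u * transform u)
        ≡⟨ cong (W u *_) (∑-square rows (χ u)) ⟩
      W u * ∑ rows (λ x → ∑ rows (λ y → χ u x * χ u y))
        ≡⟨ *-distribˡ-∑ (W u) rows _ ⟩
      ∑ rows (λ x → W u * ∑ rows (λ y → χ u x * χ u y))
        ≡⟨ ∑-cong rows (λ x → trans (*-distribˡ-∑ (W u) rows _) (∑-cong rows λ y → cong (W u *_) (χ-⊕ u x y))) ⟩
      ∑ rows (λ x → ∑ rows (λ y → W u * χ u (x ⊕ y))) ∎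

  -- Each row paired with itself contributes F(0) = n 2ⁿ; all other pairs, repeated rows included,
  -- contribute nonnegative amounts.
  energy-lower : + N * (+ n * + (2 ^ n)) ≤ energy
  energy-lower = begin
    + N * (+ n * + (2 ^ n))                 ≡⟨ cong (λ k → + k * (+ n * + (2 ^ n))) size ⟨
    + length rows * (+ n * + (2 ^ n))       ≡⟨ ∑-const rows _ ⟨
    ∑ rows (λ _ → + n * + (2 ^ n))          ≤⟨ ∑-mono-∈ rows diagonal ⟩
    ∑ rows (λ x → ∑ rows (λ y → F (x ⊕ y))) ≡⟨ energy-pairs ⟨
    energy                                  ∎
    where
    open ℤ.≤-Reasoning
    diagonal : ∀ x → x ∈ rows → + n * + (2 ^ n) ≤ ∑ rows (λ y → F (x ⊕ y))
    diagonal x x∈ = subst (_≤ ∑ rows (λ y → F (x ⊕ y)))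
      (trans (cong F (x⊕x≡zeros x)) (F-zeros n))
      (term≤∑ (λ y → F-nonneg (x ⊕ y)) x∈)

  -- The hypothesis n ≤ 2(t + 1) leaves no gap: a nonzero u has weight at most t, where the
  -- transform vanishes, or at least t + 1 ≥ n/2, where `W` is nonpositive.
  energy-upper : t ℕ.≤ n → n ℕ.≤ suc t ℕ.+ suc t → energy ≤ + n * (+ n + + n) * (+ N * + N)
  energy-upper t≤n n≤2+2t = subst (energy ≤_) at-zeros (∑-cube≤zeros n off-zeros)
    where
    at-zeros : W (zeros {n}) * (transform zeros * transform zeros) ≡ + n * (+ n + + n) * (+ N * + N)
    at-zeros = cong₂ _*_ (cong (λ s → s * (+ n + s)) (S-zeros n)) (cong (λ i → i * i) transform-zeros)
    square-nonneg : ∀ i → 0ℤ ≤ i * i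
    square-nonneg (+ k)    = 0≤+* k refl (+≤+ z≤n)
    square-nonneg -[1+ k ] = +≤+ z≤n
    off-zeros : ∀ u → 0 ℕ.< weight u → W u * (transform u * transform u) ≤ 0ℤ
    off-zeros u 0<w with weight u ℕ.≤? t
    ... | yes w≤t = ℤ.≤-reflexive (trans
            (cong (λ i → W u * (i * i)) (transform-vanishes t≤n u 0<w w≤t)) (ℤ.*-zeroʳ (W u)))
    ... | no  w≰t = subst (W u * (transform u * transform u) ≤_) (ℤ.*-zeroˡ (transform u * transform u))
            (ℤ.*-monoʳ-≤-nonNeg _ {{nonNegative (square-nonneg (transform u))}}
              (W-nonpos u (ℕ.≤-trans n≤2+2t (ℕ.+-mono-≤ (ℕ.≰⇒> w≰t) (ℕ.≰⇒> w≰t)))))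

  -- The two estimates combine to N n 2ⁿ ≤ 2 n² N², and the positive factor N n cancels.
  2^n≤2nN : .{{_ : NonZero n}} → t ℕ.≤ n → n ℕ.≤ suc t ℕ.+ suc t → 2 ^ n ℕ.≤ 2 ℕ.* n ℕ.* N
  2^n≤2nN t≤n n≤2+2t = ℕ.*-cancelˡ-≤ (N ℕ.* n) {{ℕ.m*n≢0 N n {{ℕ.>-nonZero nonempty}}}} (ℤ.drop‿+≤+ (begin
    + (N ℕ.* n ℕ.* 2 ^ n)              ≡⟨ cong +_ (ℕ.*-assoc N n (2 ^ n)) ⟩
    + (N ℕ.* (n ℕ.* 2 ^ n))            ≡⟨ trans (ℤ.pos-* N _) (cong (+ N *_) (ℤ.pos-* n (2 ^ n))) ⟩
    + N * (+ n * + (2 ^ n))            ≤⟨ energy-lower ⟩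
    energy                             ≤⟨ energy-upper t≤n n≤2+2t ⟩
    + n * (+ n + + n) * (+ N * + N)    ≡⟨ cong₂ _*_ (ℤ.pos-* n (n ℕ.+ n)) (ℤ.pos-* N N) ⟨
    + (n ℕ.* (n ℕ.+ n)) * + (N ℕ.* N)  ≡⟨ ℤ.pos-* (n ℕ.* (n ℕ.+ n)) (N ℕ.* N) ⟨
    + (n ℕ.* (n ℕ.+ n) ℕ.* (N ℕ.* N))  ≡⟨ cong +_ (rearrange n N) ⟩
    + (N ℕ.* n ℕ.* (2 ℕ.* n ℕ.* N))    ∎))
    where
    open ℤ.≤-Reasoning
    rearrange : ∀ n N → n ℕ.* (n ℕ.+ n) ℕ.* (N ℕ.* N) ≡ N ℕ.* n ℕ.* (2 ℕ.* n ℕ.* N)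
    rearrange = ℕ-Solver.solve-∀

-- From the integer bound to the rational inequality

scaled-bound⇒ℚ-bound : ∀ p k N → 409 ℕ.* p ℕ.< 1000 ℕ.* suc k ℕ.* N →
  + N ℚ./ 1 ℚ.> ((+ 409 ℚ./ 1000) ℚ.* (+ 1 ℚ./ suc k)) ℚ.* (+ p ℚ./ 1)
scaled-bound⇒ℚ-bound p k N bound = ℚ.toℚᵘ-cancel-< (begin-strict
  -- Normalised fractions are reduced by a gcd that does not compute for variables; unnormalised
  -- ones keep numerators and denominators explicit.
  ℚ.toℚᵘ (((+ 409 ℚ./ 1000) ℚ.* (+ 1 ℚ./ suc k)) ℚ.* (+ p ℚ./ 1))
    ≃⟨ ℚ.toℚᵘ-homo-* ((+ 409 ℚ./ 1000) ℚ.* (+ 1 ℚ./ suc k)) (+ p ℚ./ 1) ⟩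
  ℚ.toℚᵘ ((+ 409 ℚ./ 1000) ℚ.* (+ 1 ℚ./ suc k)) ℚᵘ.* ℚ.toℚᵘ (+ p ℚ./ 1)
    ≃⟨ ℚᵘ.*-cong (ℚᵘ.≃-trans (ℚ.toℚᵘ-homo-* (+ 409 ℚ./ 1000) (+ 1 ℚ./ suc k))
                   (ℚᵘ.*-cong (ℚ.toℚᵘ-fromℚᵘ (mkℚᵘ (+ 409) 999)) (ℚ.toℚᵘ-fromℚᵘ (mkℚᵘ (+ 1) k))))
                 (ℚ.toℚᵘ-fromℚᵘ (mkℚᵘ (+ p) 0)) ⟩
  mkℚᵘ (+ 409) 999 ℚᵘ.* mkℚᵘ (+ 1) k ℚᵘ.* mkℚᵘ (+ p) 0
    <⟨ *<* integer-bound ⟩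
  mkℚᵘ (+ N) 0
    ≃⟨ ℚ.toℚᵘ-fromℚᵘ (mkℚᵘ (+ N) 0) ⟨
  ℚ.toℚᵘ (+ N ℚ./ 1) ∎)
  where
  open ℚᵘ.≤-Reasoning
  -- This is the cross-multiplied form to which the order on unnormalised fractions unfolds, trivial
  -- factors 1 included.
  integer-bound : + 409 * + 1 * + p * + 1 < + N * + (1000 ℕ.* suc k ℕ.* 1)
  integer-bound = subst₂ _<_
    (trans (ℤ.pos-* 409 p) (sym (ℤ.*-identityʳ _)))
    (trans (cong +_ (trans (ℕ.*-comm (1000 ℕ.* suc k) N) (cong (N ℕ.*_) (sym (ℕ.*-identityʳ (1000 ℕ.* suc k)))))) (ℤ.pos-* N _))
    (+<+ bound)

mainTheorem6 : (n N : ℕ) .{{_ : NonZero n}} → 2 ∣ n →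
    OA N n (n / 2 ∸ 1) →
    + N ℚ./ 1 ℚ.> ((+ 409 ℚ./ 1000) ℚ.* (+ 1 ℚ./ n)) ℚ.* (+ (2 ^ n) ℚ./ 1)
-- As n is positive, n = 2(k + 1); the strength n/2 - 1 is then k, and n ≤ 2(k + 1) holds with
-- equality.
mainTheorem6 .(suc k ℕ.* 2) N (divides (suc k) refl) oa = scaled-bound⇒ℚ-bound (2 ^ n₀) (suc (k ℕ.* 2)) N (begin-strict
  -- The bound proved has constant 1/2 = 500/1000, and 409 < 500 because 410 + 90 = 500.
  409 ℕ.* 2 ^ n₀              <⟨ ℕ.*-monoˡ-< (2 ^ n₀) {{ℕ.m^n≢0 2 n₀}} (ℕ.m≤m+n 410 90) ⟩
  500 ℕ.* 2 ^ n₀              ≤⟨ ℕ.*-monoʳ-≤ 500 (2^n≤2nN oa′ k≤n n≤2+2k) ⟩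
  500 ℕ.* (2 ℕ.* n₀ ℕ.* N)   ≡⟨ rearrange n₀ N ⟩
  1000 ℕ.* n₀ ℕ.* N          ∎)
  where
  open ℕ.≤-Reasoning
  n₀ : ℕ
  n₀ = suc k ℕ.* 2
  oa′ : OA N n₀ k
  oa′ = subst (OA N n₀) (cong (_∸ 1) (ℕ.m*n/n≡m (suc k) 2)) oa
  n≡2+2k : ∀ k → suc k ℕ.* 2 ≡ suc k ℕ.+ suc k
  n≡2+2k = ℕ-Solver.solve-∀
  n≤2+2k : n₀ ℕ.≤ suc k ℕ.+ suc k
  n≤2+2k = ℕ.≤-reflexive (n≡2+2k k)
  k≤n : k ℕ.≤ n₀
  k≤n = ℕ.≤-trans (ℕ.n≤1+n k) (ℕ.m≤m*n (suc k) 2)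
  rearrange : ∀ n N → 500 ℕ.* (2 ℕ.* n ℕ.* N) ≡ 1000 ℕ.* n ℕ.* N
  rearrange = ℕ-Solver.solve-∀
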